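{- Let $F$ be a lean multi-clause-set with $n(F) > 0$. Then $\mathrm{minvdeg}(F) \le \mathrm{N}(\sigma(F))$. More precisely, there exists a variable $v \in \mathrm{var}(F)$ with $\mathrm{vdeg}_F(v) \le \mathrm{N}(\sigma(F))$ and $\mathrm{ld}_F(v) \le \sigma(F)$, $\mathrm{ld}_F(\overline{v}) \le \sigma(F)$.
   Context: Literals come with a fixed-point-free involution $x \mapsto \overline{x}$; variables are the positive literals, $\mathrm{var}(x)$ the underlying variable. A clause is a finite set $C$ of literals with $C \cap \overline{C} = \emptyset$. A multi-clause-set is a map $F$ from clauses to $\mathbb{N}_0$ with finitely many clauses of nonzero multiplicity; its underlying clause-set is the set of clauses with nonzero multiplicity. $\mathrm{var}(F)$ is the set of variables occurring in it, $n(F) = |\mathrm{var}(F)|$, $c(F) = \sum_C F(C)$, $\delta(F) = c(F) - n(F)$. Literal degree $\mathrm{ld}_F(x) = \sum_{C \ni x} F(C)$; $\mathrm{vdeg}_F(v) = \mathrm{ld}_F(v) + \mathrm{ld}_F(\overline{v})$; $\mathrm{minvdeg}(F) = \min_{v \in \mathrm{var}(F)} \mathrm{vdeg}_F(v)$ (and $+\infty$ if $n(F)=0$). Surplus: if $n(F) > 0$, $\sigma(F) = \min_{\emptyset \ne V \subseteq \mathrm{var}(F)} \big( \sum_{C : \mathrm{var}(C) \cap V \ne \emptyset} F(C) - |V| \big)$, and $\sigma(F) = 0$ if $n(F)=0$. A partial assignment is a map $\varphi : V \to \{0,1\}$ for a finite set $V$ of variables, with $\varphi(\overline{v}) = 1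 - \varphi(v)$; it is an autarky for a clause-set $G$ if every clause $C \in G$ containing a literal falsified by $\varphi$ also contains a literal satisfied by $\varphi$. A clause-set $G$ is lean if there is no autarky $\varphi$ for $G$ with $\mathrm{var}(\varphi) \cap \mathrm{var}(G) \ne \emptyset$; a multi-clause-set is lean iff its underlying clause-set is. The function $\mathrm{N} : \mathbb{N} \to \mathbb{N}$ is defined by $\mathrm{N}(1) = 2$ and $\mathrm{N}(k) = \max_{i \in \{2,\dots,k\}} \min(2i, \mathrm{N}(k-i+1)+i)$ for $k \ge 2$. -}

module Defs where

open import Data.Bool using (Bool; true; false; not)
open import Data.Integer as ℤ using (ℤ)
import Data.Integer.Properties as ℤ
import Data.List.Extrema
open import Data.List using (List; []; _∷_; _++_; map; concatMap; filter; length; deduplicate; zipWith; applyUpTo; applyDownFrom)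
open import Data.List.Extrema.Nat using (max)
open import Data.List.Relation.Unary.All using (All)
open import Data.List.Relation.Unary.Any using (Any; any?)
import Data.List.Membership.DecPropositional as DecMembership
open import Data.Maybe as Maybe using (Maybe; just; Is-just)
open import Data.Nat using (ℕ; zero; suc; _+_; _*_; _∸_; _⊓_; _≤_)
import Data.Nat.Properties as ℕ
open import Data.Product using (∃-syntax; _×_)
open import Function using (_∘_)
open import Relation.Binary using (TotalOrder)
open import Relation.Binary.Definitions using (DecidableEquality)
open import Relation.Binary.PropositionalEquality using (_≡_; refl; sym; cong; cong₂; module ≡-Reasoning)
import Relation.Binary.Construct.Add.Supremum.NonStrict as Supremum
open import Relation.Nullary using (¬_; yes; no)
open import Relation.Nullary.Construct.Add.Supremum using (_⁺; [_]; ⊤⁺)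
import Relation.Nullary.Decidable as Dec

-- ℕ ∪ {+∞}; the element +∞ is ⊤⁺.

ℕ∞ : Set
ℕ∞ = ℕ ⁺

open Supremum _≤_ public using (_≤⁺_)

≤⁺-totalOrder : TotalOrder _ _ _
≤⁺-totalOrder = record
  { isTotalOrder = Supremum.≤⁺-isTotalOrder-≡ _≤_ ℕ.≤-isTotalOrder }

open Data.List.Extrema ≤⁺-totalOrder public using () renaming (min to min∞)
open Data.List.Extrema ℤ.≤-totalOrder public using () renaming (min to minℤ)

-- Course-of-values recursion: Ns k is N k ∷ … ∷ N 1 ∷ [].  For m ≥ 1 the j-th
-- entry (from 0) of Ns m is N (m ∸ j), which is N (k ∸ i + 1) for k = m + 1
-- and i = 2 + j.  N-rec recovers the usual form.  The value N 0 is arbitrary.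

nextN : ℕ → List ℕ → ℕ
nextN zero      _  = 2
nextN m@(suc _) ns =
  max 0 (zipWith (λ i p → (2 * i) ⊓ (p + i)) (applyUpTo (2 +_) m) ns)

Ns : ℕ → List ℕ
Ns zero    = []
Ns (suc k) = nextN k (Ns k) ∷ Ns k

N : ℕ → ℕ
N zero    = 0
N (suc k) = nextN k (Ns k)

private
  Ns≡ : ∀ k → Ns k ≡ applyDownFrom (N ∘ suc) k
  Ns≡ zero    = refl
  Ns≡ (suc k) = cong (N (suc k) ∷_) (Ns≡ k)

  zipWith-reindex : ∀ (a g h : ℕ → ℕ) n → (∀ j → h (n ∸ suc j) ≡ g (a j)) →
    zipWith (λ i p → (2 * i) ⊓ (p + i)) (applyUpTo a n) (applyDownFrom h n)
    ≡ map (λ i → (2 * i) ⊓ (g i + i)) (applyUpTo a n)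
  zipWith-reindex a g h zero    eq = refl
  zipWith-reindex a g h (suc n) eq =
    cong₂ _∷_ (cong (λ p → (2 * a 0) ⊓ (p + a 0)) (eq 0))
              (zipWith-reindex (a ∘ suc) g h n (eq ∘ suc))

-- With k = m + 2, the index i runs through 2, …, k.

N-rec : ∀ m → let k = 2 + m in
  N k ≡ max 0 (map (λ i → (2 * i) ⊓ (N (k ∸ i + 1) + i)) (applyUpTo (2 +_) (suc m)))
N-rec m = begin
  max 0 (zipWith f is (Ns (suc m)))
    ≡⟨ cong (max 0 ∘ zipWith f is) (Ns≡ (suc m)) ⟩
  max 0 (zipWith f is (applyDownFrom (N ∘ suc) (suc m)))
    ≡⟨ cong (max 0) (zipWith-reindex (2 +_) (λ i → N ((2 + m) ∸ i + 1)) (N ∘ suc) (suc m)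
         (λ j → cong N (sym (ℕ.+-comm (m ∸ j) 1)))) ⟩
  max 0 (map (λ i → (2 * i) ⊓ (N ((2 + m) ∸ i + 1) + i)) is) ∎
  where
  open ≡-Reasoning
  f : ℕ → ℕ → ℕ
  f i p = (2 * i) ⊓ (p + i)
  is : List ℕ
  is = applyUpTo (2 +_) (suc m)

sublists : ∀ {a} {A : Set a} → List A → List (List A)
sublists []       = [] ∷ []
sublists (x ∷ xs) = map (x ∷_) (sublists xs) ++ sublists xs

nonemptySublists : ∀ {a} {A : Set a} → List A → List (List A)
nonemptySublists []       = []
nonemptySublists (x ∷ xs) = map (x ∷_) (sublists xs) ++ nonemptySublists xs

module Clauses {a} {Var : Set a} (_≟_ : DecidableEquality Var) where

  open DecMembership _≟_ using (_∈_; _∈?_)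

  data Literal : Set a where
    pos neg : Var → Literal

  var : Literal → Var
  var (pos v) = v
  var (neg v) = v

  complement : Literal → Literal
  complement (pos v) = neg v
  complement (neg v) = pos v

  _≟ˡ_ : DecidableEquality Literal
  pos v ≟ˡ pos w = Dec.map′ (cong pos) (λ where refl → refl) (v ≟ w)
  pos v ≟ˡ neg w = no λ ()
  neg v ≟ˡ pos w = no λ ()
  neg v ≟ˡ neg w = Dec.map′ (cong neg) (λ where refl → refl) (v ≟ w)

  open DecMembership _≟ˡ_ using () renaming (_∈_ to _∈ˡ_; _∈?_ to _∈ˡ?_)

  -- The list of literals stands for the finite set of its members; order and
  -- repetition in it are never inspected.

  record Clause : Set a where
    field
      literals  : List Literal
      clashFree : ∀ x → x ∈ˡ literals → ¬ (complement x ∈ˡ literals)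

  open Clause public

  -- The finitely supported map F from clauses to multiplicities is given by
  -- a list in which a clause C (up to equality of literal sets) occurs F(C)
  -- times.  Hence Σ_{C : P(C)} F(C) is the number of entries satisfying P,
  -- and the underlying clause-set consists of the entries.

  MultiClauseSet : Set a
  MultiClauseSet = List Clause

  vars : MultiClauseSet → List Var
  vars F = deduplicate _≟_ (concatMap (map var ∘ literals) F)

  n : MultiClauseSet → ℕ
  n F = length (vars F)

  ld : MultiClauseSet → Literal → ℕ
  ld F x = length (filter (λ C → x ∈ˡ? literals C) F)

  vdeg : MultiClauseSet → Var → ℕ
  vdeg F v = ld F (pos v) + ld F (neg v)

  minvdeg : MultiClauseSet → ℕ∞
  minvdeg F = min∞ ⊤⁺ (map ([_] ∘ vdeg F) (vars F))

  touching : List Var → MultiClauseSet → MultiClauseSet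
  touching V F = filter (λ C → any? (λ x → var x ∈? V) (literals C)) F

  excess : MultiClauseSet → List Var → ℤ
  excess F V = ℤ.+ length (touching V F) ℤ.- ℤ.+ length V

  -- vars F has no repetitions, so its nonempty sublists enumerate the sets
  -- ∅ ≠ V ⊆ var(F) and have length |V|.  The first argument of minℤ is an
  -- additional candidate for the minimum: it is the one for V = var(F), hence
  -- redundant if var(F) is nonempty, and it is 0 if var(F) is empty.

  σ : MultiClauseSet → ℤ
  σ F = minℤ (excess F (vars F)) (map (excess F) (nonemptySublists (vars F)))

  record PartialAssignment : Set a where
    field
      value        : Var → Maybe Bool
      finiteDomain : ∃[ V ] (∀ v → Is-just (value v) → v ∈ V)

  open PartialAssignment public

  _∈dom_ : Var → PartialAssignment → Set
  v ∈dom φ = Is-just (value φ v)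

  evaluate : PartialAssignment → Literal → Maybe Bool
  evaluate φ (pos v) = value φ v
  evaluate φ (neg v) = Maybe.map not (value φ v)

  Satisfies Falsifies : PartialAssignment → Literal → Set
  Satisfies φ x = evaluate φ x ≡ just true
  Falsifies φ x = evaluate φ x ≡ just false

  Autarky : PartialAssignment → MultiClauseSet → Set a
  Autarky φ F =
    All (λ C → Any (Falsifies φ) (literals C) → Any (Satisfies φ) (literals C)) F

  Lean : MultiClauseSet → Set a
  Lean F = ¬ (∃[ φ ] Autarky φ F × ∃[ v ] v ∈ vars F × v ∈dom φ)

-- Let V attain the surplus k of the lean F.  The clauses touching V, restricted
-- to V, are unsatisfiable, since a satisfying assignment would be an autarky of
-- F; delete r clauses from them to reach a minimally unsatisfiable G.  Such a G
-- has more clauses than variables, so if G missed part of V, that part would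
-- have smaller excess than V.  Hence G has deficiency k − r, and the bound for
-- G gives the one for F because N (k − r) + r ≤ N k.
--
-- For minimally unsatisfiable G of deficiency k, add literals to clauses as
-- long as unsatisfiability persists; degrees only grow.  In the resulting
-- saturated G let v have minimum degree, and make true a literal x of v of
-- maximal degree i.  Saturation makes the result minimally unsatisfiable, and
-- minimality of the degree of v keeps all other variables, so the deficiency is
-- k − i + 1, which is positive by induction; hence i ≤ k.  By induction some
-- variable has degree at most N (k − i + 1) there, hence at most
-- N (k − i + 1) + i in G, and vdeg v ≤ min (2i, N (k − i + 1) + i) ≤ N k
-- if i ≥ 2, while vdeg v ≤ 2 if i = 1.

module Submission where

open import Defs
open import Level using (Level; _⊔_)
open import Data.Bool using (Bool; true; false; not; if_then_else_; _∧_)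
import Data.Bool.Properties as Bool
open import Data.Fin using (Fin)
import Data.Fin.Properties as Fin
import Data.Integer as ℤ
import Data.Integer.Properties as ℤ
open import Data.List
  using (List; []; _∷_; map; applyUpTo; length; filter; cartesianProduct; concatMap; lookup; allFin; tabulate)
import Data.List.Extrema as Extrema
import Data.List.Membership.DecPropositional as DecMembership
open import Data.List.Extrema.Nat
  using (max; max<v⁺; xs≤max; argmin; argmin-sel; f[argmin]≤f[⊤]; f[argmin]≤f[xs])
open import Data.List.Membership.Propositional using (_∈_; find; lose)
open import Data.List.Membership.Propositional.Properties
  using (∈-applyUpTo⁺; ∈-map⁺; ∈-filter⁺; ∈-filter⁻; ∈-cartesianProduct⁺; ∈-++⁺ˡ; ∈-++⁺ʳ; ∈-++⁻
        ; ∈-map⁻; ∈-allFin)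
open import Data.List.Properties
  using (filter-all; filter-reject; filter-accept; filter-some; filter-none; tabulate-lookup; map-tabulate)
open import Data.List.Relation.Binary.Sublist.Propositional
  using (_⊆_; _∷ʳ_; ⊆-refl; ⊆-trans)
  renaming ([] to []⊆; _∷_ to _∷⊆_; lookup to ⊆-lookup)
open import Data.List.Relation.Binary.Sublist.Propositional.Properties
  using (filter-⊆; All-resp-⊆; length-mono-≤)
open import Data.List.Relation.Unary.All as All using (All; []; _∷_)
import Data.List.Relation.Unary.All.Properties as All
open import Data.List.Relation.Unary.AllPairs using ([]; _∷_)
open import Data.List.Relation.Unary.Any as Any using (Any; here; there; any?)
import Data.List.Relation.Unary.Any.Properties as Any
open import Data.List.Relation.Unary.Unique.Propositional using (Unique)
import Data.List.Relation.Unary.Unique.Propositional.Properties as Unique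
import Data.List.Relation.Unary.Unique.DecPropositional.Properties as UniqueDec
open import Data.Maybe using (Maybe; just; nothing; Is-just)
import Data.Maybe.Relation.Unary.Any as MaybeAny
import Data.Maybe.Properties as Maybe
open import Data.Nat using (ℕ; zero; suc; _+_; _*_; _∸_; _⊓_; _≤_; _<_; z≤n; s≤s)
open import Data.Nat.Properties
open import Data.Product using (∃; ∃-syntax; _×_; _,_; proj₁; proj₂)
open import Data.Sum using (_⊎_; inj₁; inj₂; [_,_]′)
open import Function using (_∘_; const; id)
open import Relation.Binary.Definitions using (DecidableEquality)
open import Relation.Binary.PropositionalEquality hiding (J)
open import Relation.Nullary using (¬_; Dec; yes; no; does; contradiction)
open import Relation.Nullary.Construct.Add.Supremum using ([_]; ⊤⁺)
import Relation.Binary.Construct.Add.Supremum.NonStrict as Supremum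
open import Relation.Nullary.Decidable using (map′; _⊎-dec_; ¬?; dec-true; dec-false; decidable-stable)
open import Relation.Unary using (Pred; Decidable)

-- The function `N`: lower bounds and growth.

N-lower : ∀ k {a} → 2 ≤ a → (2 * a) ⊓ (N (suc k) + a) ≤ N (k + a)
N-lower k {suc (suc a)} (s≤s (s≤s z≤n)) = begin
  f (suc k)                  ≡⟨ cong f (trans (+-comm 1 k) (cong (_+ 1) (sym (m+n∸n≡m k a)))) ⟩
  f (2 + (k + a) ∸ (2 + a) + 1)
    -- The term with i = 2 + a in the maximum of `N-rec`; the step before only rewrites `suc k` into
    -- the argument that this term has.
    ≤⟨ All.lookup (xs≤max 0 _) (∈-map⁺ g (∈-applyUpTo⁺ (2 +_) (s≤s (m≤n+m a k)))) ⟩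
  max 0 (map g (applyUpTo (2 +_) (suc (k + a)))) ≡⟨ sym (N-rec (k + a)) ⟩
  N (2 + (k + a))            ≡⟨ cong N (trans (cong suc (sym (+-suc k a))) (sym (+-suc k (suc a)))) ⟩
  N (k + (2 + a))            ∎
  where
  open ≤-Reasoning
  f : ℕ → ℕ
  f p = (2 * (2 + a)) ⊓ (N p + (2 + a))
  g : ℕ → ℕ
  g i = (2 * i) ⊓ (N (2 + (k + a) ∸ i + 1) + i)

-- After the first case, term i of the maximum for one argument is compared with term i + 1 for the
-- next: both contain the same value of `N`, and both sides of the minimum have grown.
N-suc : ∀ k → N (suc k) < N (2 + k)
N-suc zero    = s≤s (s≤s (s≤s z≤n))
N-suc (suc m) = begin-strict
  N (2 + m)                                  ≡⟨ N-rec m ⟩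
  max 0 (map g (applyUpTo (2 +_) (suc m)))   <⟨ max<v⁺ {xs = map g (applyUpTo (2 +_) (suc m))} 0<N
                                                  (All.map⁺ (All.applyUpTo⁺₁ (2 +_) (suc m) entry)) ⟩
  N (3 + m)                                  ∎
  where
  open ≤-Reasoning
  g : ℕ → ℕ
  g i = (2 * i) ⊓ (N (2 + m ∸ i + 1) + i)
  -- `max` has the default candidate 0, so a strict bound on it must itself be positive.
  0<N : 0 < N (3 + m)
  0<N = begin-strict
    0                            <⟨ s≤s z≤n ⟩
    2                            ≤⟨ ⊓-glb (s≤s (s≤s z≤n)) (m≤n+m 2 (N (2 + m))) ⟩
    (2 * 2) ⊓ (N (2 + m) + 2)    ≤⟨ N-lower (suc m) ≤-refl ⟩
    N (suc m + 2)                ≡⟨ cong N (+-comm (suc m) 2) ⟩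
    N (3 + m)                    ∎
  entry : ∀ {j} → j < suc m → g (2 + j) < N (3 + m)
  entry {j} (s≤s j≤m) = begin-strict
    (2 * (2 + j)) ⊓ (N (m ∸ j + 1) + (2 + j))
      <⟨ ⊓-mono-< (*-monoʳ-< 2 (n<1+n (2 + j))) (+-monoʳ-< (N (m ∸ j + 1)) (n<1+n (2 + j))) ⟩
    (2 * (3 + j)) ⊓ (N (m ∸ j + 1) + (3 + j))
      ≡⟨ cong (λ p → (2 * (3 + j)) ⊓ (N p + (3 + j))) (+-comm (m ∸ j) 1) ⟩
    (2 * (3 + j)) ⊓ (N (suc (m ∸ j)) + (3 + j)) ≤⟨ N-lower (m ∸ j) (s≤s (s≤s z≤n)) ⟩
    N (m ∸ j + (3 + j))          ≡⟨ cong N (trans (+-comm (m ∸ j) (3 + j)) (cong (3 +_) (m+[n∸m]≡n j≤m))) ⟩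
    N (3 + m)                    ∎

-- Iterates `N-suc`. This pays for restoring r deleted rows, which raises a degree by at most r.
N-+ : ∀ k r → N (suc k) + r ≤ N (suc k + r)
N-+ k zero    = ≤-reflexive (trans (+-identityʳ _) (cong N (sym (+-identityʳ (suc k)))))
N-+ k (suc r) = begin
  N (suc k) + suc r   ≡⟨ +-suc (N (suc k)) r ⟩
  suc (N (suc k) + r) ≤⟨ s≤s (N-+ k r) ⟩
  suc (N (suc k + r)) ≤⟨ N-suc (k + r) ⟩
  N (2 + k + r)       ≡⟨ cong N (sym (+-suc (suc k) r)) ⟩
  N (suc k + suc r)   ∎
  where open ≤-Reasoning

2+k≤N : ∀ k → 2 + k ≤ N (suc k)
2+k≤N k = N-+ 0 k

-- Counting in lists, and sublists.

module _ {a} {A : Set a} where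

  private variable
    p q r : Level
    P : Pred A p
    Q : Pred A q
    xs ys : List A

  count : Decidable P → List A → ℕ
  count P? xs = length (filter P? xs)

  count-mono : (P? : Decidable P) (Q? : Decidable Q) →
               (∀ {x} → x ∈ xs → P x → Q x) → count P? xs ≤ count Q? xs
  count-mono {xs = []}     P? Q? P⇒Q = z≤n
  count-mono {xs = x ∷ xs} P? Q? P⇒Q with ih ← count-mono {xs = xs} P? Q? (P⇒Q ∘ there) | P? x | Q? x
  ... | yes px | yes qx = s≤s ih
  ... | yes px | no ¬qx = contradiction (P⇒Q (here refl) px) ¬qx
  ... | no ¬px | yes qx = m≤n⇒m≤1+n ih
  ... | no ¬px | no ¬qx = ih

  count-∁ : (P? : Decidable P) (xs : List A) → count P? xs + count (¬? ∘ P?) xs ≡ length xs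
  count-∁ P? []       = refl
  count-∁ P? (x ∷ xs) with ih ← count-∁ P? xs | P? x
  ... | yes _ = cong suc ih
  ... | no  _ = trans (+-suc _ _) (cong suc ih)

  -- Each entry dropped from `ys` lowers the count by at most one; the additive form avoids
  -- truncated subtraction.
  count-⊆ : (P? : Decidable P) → xs ⊆ ys → count P? ys + length xs ≤ count P? xs + length ys
  count-⊆ P? []⊆ = z≤n
  count-⊆ {xs = xs} {ys = y ∷ ys} P? (_ ∷ʳ s) with ih ← count-⊆ P? s | does (P? y)
  ... | true  = ≤-trans (s≤s ih) (≤-reflexive (sym (+-suc (count P? xs) (length ys))))
  ... | false = ≤-trans ih (+-monoʳ-≤ (count P? xs) (n≤1+n (length ys)))
  count-⊆ {xs = x ∷ xs} {ys = x ∷ ys} P? (refl ∷⊆ s) with ih ← count-⊆ P? s | does (P? x)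
  ... | true  = s≤s (subst₂ _≤_ (sym (+-suc _ _)) (sym (+-suc _ _)) (s≤s ih))
  ... | false = subst₂ _≤_ (sym (+-suc _ _)) (sym (+-suc _ _)) (s≤s ih)

  count-∷ : (P? : Decidable P) (x : A) (xs : List A) → count P? xs ≤ count P? (x ∷ xs)
  count-∷ P? x xs with does (P? x)
  ... | true  = n≤1+n _
  ... | false = ≤-refl

  -- Compares counts over all rows with counts over the rows touching a set of variables.
  count-filter : {R : Pred A r} (P? : Decidable P) (Q? : Decidable Q) (R? : Decidable R) →
                 (∀ {x} → x ∈ xs → P x → Q x × R x) → count P? xs ≤ count R? (filter Q? xs)
  count-filter {xs = []}     P? Q? R? P⇒QR = z≤n
  count-filter {xs = x ∷ xs} P? Q? R? P⇒QR
    with ih ← count-filter {xs = xs} P? Q? R? (P⇒QR ∘ there) | P? x | Q? x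
  ... | no _  | no _  = ih
  ... | no _  | yes _ = ≤-trans ih (count-∷ R? x (filter Q? xs))
  ... | yes p | no ¬q = contradiction (proj₁ (P⇒QR (here refl) p)) ¬q
  ... | yes p | yes _ = ≤-trans (s≤s ih)
    (≤-reflexive (cong length (sym (filter-accept R? (proj₂ (P⇒QR (here refl) p))))))

  Unique-⊆ : xs ⊆ ys → Unique ys → Unique xs
  Unique-⊆ []⊆          _          = []
  Unique-⊆ (_ ∷ʳ s)     (_ ∷ u)    = Unique-⊆ s u
  Unique-⊆ (refl ∷⊆ s)  (∉ ∷ u)    = All-resp-⊆ s ∉ ∷ Unique-⊆ s u

  ∈-sublists⁺ : xs ⊆ ys → xs ∈ sublists ys
  ∈-sublists⁺ []⊆                = here refl
  ∈-sublists⁺ {ys = y ∷ ys} (_ ∷ʳ s)      = ∈-++⁺ʳ (map (y ∷_) (sublists ys)) (∈-sublists⁺ s)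
  ∈-sublists⁺ {ys = y ∷ ys} (refl ∷⊆ s)   = ∈-++⁺ˡ (∈-map⁺ (y ∷_) (∈-sublists⁺ s))

  ∈-sublists⁻ : ∀ ys → xs ∈ sublists ys → xs ⊆ ys
  ∈-sublists⁻ []       (here refl) = []⊆
  ∈-sublists⁻ (y ∷ ys) xs∈ with ∈-++⁻ (map (y ∷_) (sublists ys)) xs∈
  ... | inj₂ xs∈′ = y ∷ʳ ∈-sublists⁻ ys xs∈′
  ... | inj₁ xs∈′ with zs , zs∈ , refl ← ∈-map⁻ (y ∷_) xs∈′ = refl ∷⊆ ∈-sublists⁻ ys zs∈

  ∈-nonemptySublists⁺ : xs ⊆ ys → 0 < length xs → xs ∈ nonemptySublists ys
  ∈-nonemptySublists⁺ {ys = y ∷ ys} (_ ∷ʳ s) 0<    =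
    ∈-++⁺ʳ (map (y ∷_) (sublists ys)) (∈-nonemptySublists⁺ s 0<)
  ∈-nonemptySublists⁺ {ys = y ∷ ys} (refl ∷⊆ s) _ = ∈-++⁺ˡ (∈-map⁺ (y ∷_) (∈-sublists⁺ s))

  ∈-nonemptySublists⁻ : ∀ ys → xs ∈ nonemptySublists ys → xs ⊆ ys × 0 < length xs
  ∈-nonemptySublists⁻ (y ∷ ys) xs∈ with ∈-++⁻ (map (y ∷_) (sublists ys)) xs∈
  ... | inj₁ xs∈′ with zs , zs∈ , refl ← ∈-map⁻ (y ∷_) xs∈′ = refl ∷⊆ ∈-sublists⁻ ys zs∈ , s≤s z≤n
  ... | inj₂ xs∈′ with xs⊆ , 0< ← ∈-nonemptySublists⁻ ys xs∈′ = y ∷ʳ xs⊆ , 0<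

count-map : ∀ {a b p} {A : Set a} {B : Set b} {P : Pred B p} (P? : Decidable P) (f : A → B) xs →
            count P? (map f xs) ≡ count (P? ∘ f) xs
count-map P? f []       = refl
count-map P? f (x ∷ xs) with does (P? (f x))
... | true  = cong suc (count-map P? f xs)
... | false = count-map P? f xs

count-lookup : ∀ {a p} {A : Set a} {P : Pred A p} (P? : Decidable P) (xs : List A) →
               count P? xs ≡ count (P? ∘ lookup xs) (allFin (length xs))
count-lookup P? xs = begin
  count P? xs                                     ≡⟨ cong (count P?) (sym (tabulate-lookup xs)) ⟩
  count P? (tabulate (lookup xs))                 ≡⟨ cong (count P?) (sym (map-tabulate id (lookup xs))) ⟩
  count P? (map (lookup xs) (allFin (length xs))) ≡⟨ count-map P? (lookup xs) (allFin (length xs)) ⟩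
  count (P? ∘ lookup xs) (allFin (length xs))     ∎
  where open ≡-Reasoning

-- Lets two excesses be compared by cross-addition, so that the counting stays in the natural
-- numbers.
minus-< : ∀ m n o p → m + p < o + n → ℤ.+ m ℤ.- ℤ.+ n ℤ.< ℤ.+ o ℤ.- ℤ.+ p
minus-< m n o p lt = begin-strict
  ℤ.+ m ℤ.- ℤ.+ n       ≡⟨ ℤ.m-n≡m⊖n m n ⟩
  m ℤ.⊖ n               ≡⟨ sym (ℤ.+-cancelˡ-⊖ p m n) ⟩
  (p + m) ℤ.⊖ (p + n)   <⟨ ℤ.⊖-monoˡ-< (p + n) (subst₂ _<_ (+-comm m p) (+-comm o n) lt) ⟩
  (n + o) ℤ.⊖ (p + n)   ≡⟨ cong ((n + o) ℤ.⊖_) (+-comm p n) ⟩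
  (n + o) ℤ.⊖ (n + p)   ≡⟨ ℤ.+-cancelˡ-⊖ n o p ⟩
  o ℤ.⊖ p               ≡⟨ sym (ℤ.m-n≡m⊖n o p) ⟩
  ℤ.+ o ℤ.- ℤ.+ p       ∎
  where open ℤ.≤-Reasoning

module Removal {a} {A : Set a} (_≟_ : DecidableEquality A) where

  without : A → List A → List A
  without x = filter (λ y → ¬? (y ≟ x))

  length-without : ∀ {x xs} → Unique xs → x ∈ xs → length xs ≡ suc (length (without x xs))
  length-without {x} {_ ∷ xs} (x∉ ∷ _) (here refl) = cong (suc ∘ length)
    (sym (trans (filter-reject (λ y → ¬? (y ≟ x)) (λ ¬eq → ¬eq refl))
                (filter-all (λ y → ¬? (y ≟ x)) (All.map (_∘ sym) x∉))))
  length-without {x} {y ∷ xs} (y∉ ∷ uniq) (there x∈) = cong suc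
    (trans (length-without uniq x∈)
           (cong length (sym (filter-accept (λ y → ¬? (y ≟ x)) (All.lookup y∉ x∈)))))

-- A multi-clause-set is a partial sign matrix, given by a list of rows
-- (clauses) and a list of columns (variables); deleting clauses and assigning
-- variables only shrink these lists, and the entries stay untouched.

module SignMatrix {r a} {Row : Set r} {Var : Set a}
  (_≟ᵣ_ : DecidableEquality Row) (_≟_ : DecidableEquality Var) where

  open Removal

  Matrix : Set (r ⊔ a)
  Matrix = Row → Var → Maybe Bool

  Assignment : Set a
  Assignment = Var → Bool

  _≟ₑ_ : DecidableEquality (Maybe Bool)
  _≟ₑ_ = Maybe.≡-dec Bool._≟_

  private variable
    M M′ : Matrix
    X : List Var
    I : List Row
    φ ψ : Assignment
    i j : Row
    v w : Var
    b : Bool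

  -- Assignments and decidability of satisfiability.

  infix 6 _[_≔_]

  _[_≔_] : Assignment → Var → Bool → Assignment
  (φ [ v ≔ b ]) w = if does (w ≟ v) then b else φ w

  update-same : ∀ φ v b → (φ [ v ≔ b ]) v ≡ b
  update-same φ v b rewrite dec-true (v ≟ v) refl = refl

  update-other : ∀ φ b → w ≢ v → (φ [ v ≔ b ]) w ≡ φ w
  update-other {w} {v} φ b w≢v rewrite dec-false (w ≟ v) w≢v = refl

  -- Since `P` sees only the values on `X`, branching on the two values of each variable in `X`
  -- suffices, and at the end any single assignment represents all others.
  ∃assignment? : ∀ {p} (X : List Var) {P : Pred Assignment p} → Decidable P →
    (∀ {φ ψ} → (∀ {v} → v ∈ X → φ v ≡ ψ v) → P φ → P ψ) → Dec (∃ P)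
  ∃assignment? []      P? ext =
    map′ (λ p → const false , p) (λ (φ , p) → ext (λ ()) p) (P? (const false))
  ∃assignment? (x ∷ X) {P} P? ext = map′ from to (branch? true ⊎-dec branch? false)
    where
    Branch : Bool → Set _
    Branch b = ∃[ φ ] P (φ [ x ≔ b ])
    branch? : ∀ b → Dec (Branch b)
    branch? b = ∃assignment? X (λ φ → P? (φ [ x ≔ b ])) (λ eq → ext (agree eq))
      where
      agree : (∀ {v} → v ∈ X → φ v ≡ ψ v) →
              ∀ {v} → v ∈ x ∷ X → (φ [ x ≔ b ]) v ≡ (ψ [ x ≔ b ]) v
      agree eq {v} v∈ with v ≟ x | v∈
      ... | yes _  | _         = refl
      ... | no v≢x | here v≡x  = contradiction v≡x v≢x
      ... | no _   | there v∈X = eq v∈X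
    from : Branch true ⊎ Branch false → ∃ P
    from = [ (λ (φ , p) → _ , p) , (λ (φ , p) → _ , p) ]′
    -- Resetting `x` to its own value gives only a pointwise equal assignment, so `ext` is needed to
    -- move a witness into its branch.
    unchanged : ∀ φ v → φ v ≡ (φ [ x ≔ φ x ]) v
    unchanged φ v with v ≟ x
    ... | yes refl = refl
    ... | no _     = refl
    to : ∃ P → Branch true ⊎ Branch false
    to (φ , p) with φ x in eq
    ... | true  = inj₁ (φ , ext (λ {v} _ → trans (unchanged φ v) (cong (λ b → (φ [ x ≔ b ]) v) eq)) p)
    ... | false = inj₂ (φ , ext (λ {v} _ → trans (unchanged φ v) (cong (λ b → (φ [ x ≔ b ]) v) eq)) p)

  Satisfies : Matrix → List Var → Assignment → Row → Set a
  Satisfies M X φ i = Any (λ v → M i v ≡ just (φ v)) X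

  satisfies? : ∀ M X φ → Decidable (Satisfies M X φ)
  satisfies? M X φ i = any? (λ v → M i v ≟ₑ just (φ v)) X

  satisfies-ext : (∀ {v} → v ∈ X → φ v ≡ ψ v) → Satisfies M X φ i → Satisfies M X ψ i
  satisfies-ext φ≈ψ sat with v , v∈X , eq ← find sat =
    lose v∈X (trans eq (cong just (φ≈ψ v∈X)))

  Satisfiable : Matrix → List Var → List Row → Set (r ⊔ a)
  Satisfiable M X I = ∃[ φ ] All (Satisfies M X φ) I

  satisfiable? : ∀ M X I → Dec (Satisfiable M X I)
  satisfiable? M X I = ∃assignment? X (λ φ → All.all? (satisfies? M X φ) I)
    (λ φ≈ψ → All.map (satisfies-ext {M = M} φ≈ψ))

  -- Minimal unsatisfiability and degrees.

  Critical : Matrix → List Var → List Row → Row → Set (r ⊔ a)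
  Critical M X I j = ∃[ φ ] (∀ {i} → i ∈ I → i ≢ j → Satisfies M X φ i)

  -- The field `occurs` excludes empty columns, so that `length I` minus `length X` is the
  -- deficiency.
  record MinUnsat (M : Matrix) (X : List Var) (I : List Row) : Set (r ⊔ a) where
    field
      unsat    : ¬ Satisfiable M X I
      critical : j ∈ I → Critical M X I j
      occurs   : v ∈ X → Any (λ i → M i v ≢ nothing) I

  open MinUnsat

  ld : Matrix → List Row → Var → Bool → ℕ
  ld M I v b = count (λ i → M i v ≟ₑ just b) I

  vdeg : Matrix → List Row → Var → ℕ
  vdeg M I v = count (λ i → ¬? (M i v ≟ₑ nothing)) I

  vdeg≡ld+ld : ∀ M I v b → vdeg M I v ≡ ld M I v b + ld M I v (not b)
  vdeg≡ld+ld M []      v b = refl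
  vdeg≡ld+ld M (i ∷ I) v b with M i v | b | vdeg≡ld+ld M I v b
  ... | nothing    | true  | ih = ih
  ... | nothing    | false | ih = ih
  ... | just true  | true  | ih = cong suc ih
  ... | just true  | false | ih = trans (cong suc ih) (sym (+-suc _ _))
  ... | just false | true  | ih = trans (cong suc ih) (sym (+-suc _ _))
  ... | just false | false | ih = cong suc ih

  infix 4 _⊑_

  _⊑_ : Matrix → Matrix → Set (r ⊔ a)
  M ⊑ M′ = ∀ i v {b} → M i v ≡ just b → M′ i v ≡ just b

  ⊑-occurs : M ⊑ M′ → M i v ≢ nothing → M′ i v ≢ nothing
  ⊑-occurs {M} {i = i} {v} M⊑M′ ne eq with M i v in eq′
  ... | nothing = ne refl
  ... | just b with () ← trans (sym (M⊑M′ _ _ eq′)) eq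

  ⊑-satisfies : M ⊑ M′ → Satisfies M X φ i → Satisfies M′ X φ i
  ⊑-satisfies M⊑M′ = Any.map (M⊑M′ _ _)

  ⊑-critical : M ⊑ M′ → Critical M X I j → Critical M′ X I j
  ⊑-critical M⊑M′ (φ , sat) = φ , λ i∈I i≢j → ⊑-satisfies M⊑M′ (sat i∈I i≢j)

  -- Greedy deletion; L lists the rows that remain to be tried.

  minimise : ∀ L → ¬ Satisfiable M X I →
    ∃[ J ] J ⊆ I × ¬ Satisfiable M X J × (∀ {j} → j ∈ L → j ∈ J → Critical M X J j)
  minimise {I = I} [] ¬sat = I , ⊆-refl , ¬sat , λ ()
  minimise {M} {X} {I} (l ∷ L) ¬sat with satisfiable? M X (without _≟ᵣ_ l I)
  ... | no ¬sat′ with J , J⊆ , ¬satJ , crit ← minimise L ¬sat′ =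
    J , ⊆-trans J⊆ (filter-⊆ _ I) , ¬satJ , λ where
      (here refl) l∈J → contradiction refl (proj₂ (∈-filter⁻ (λ i → ¬? (i ≟ᵣ l)) {xs = I} (⊆-lookup J⊆ l∈J)))
      (there j∈L) j∈J → crit j∈L j∈J
  -- The row `l` is kept; the assignment found for the other rows of `I` still shows it critical
  -- after later deletions.
  ... | yes (φ , sat) with J , J⊆ , ¬satJ , crit ← minimise L ¬sat =
    J , J⊆ , ¬satJ , λ where
      (here refl) _ → φ , λ i∈J i≢l →
        All.lookup sat (∈-filter⁺ (λ i → ¬? (i ≟ᵣ l)) (⊆-lookup J⊆ i∈J) i≢l)
      (there j∈L) j∈J → crit j∈L j∈J

  -- Saturation by adding literals.

  setEntry : Matrix → Row → Var → Bool → Matrix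
  setEntry M j v b i w = if does (i ≟ᵣ j) ∧ does (w ≟ v) then just b else M i w

  setEntry-same : ∀ M j v b → setEntry M j v b j v ≡ just b
  setEntry-same M j v b rewrite dec-true (j ≟ᵣ j) refl | dec-true (v ≟ v) refl = refl

  setEntry-other : ∀ M j v b {i w} → i ≢ j ⊎ w ≢ v → setEntry M j v b i w ≡ M i w
  setEntry-other M j v b {i} {w} ne with i ≟ᵣ j | w ≟ v | ne
  ... | yes i≡j | yes w≡v | inj₁ i≢j = contradiction i≡j i≢j
  ... | yes i≡j | yes w≡v | inj₂ w≢v = contradiction w≡v w≢v
  ... | yes _   | no _    | _        = refl
  ... | no _    | _       | _        = refl

  setEntry-⊑ : M j v ≡ nothing → M ⊑ setEntry M j v b
  setEntry-⊑ {j = j} {v} eq i w eq′ with i ≟ᵣ j | w ≟ v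
  ... | yes refl | yes refl with () ← trans (sym eq) eq′
  ... | yes _    | no _     = eq′
  ... | no _     | _        = eq′

  -- Row j contains v, or adding the literal v = b to it destroys
  -- unsatisfiability: a φ satisfying the extended rows must use that literal,
  -- because the original rows are unsatisfiable.

  Resolved : List Var → List Row → Matrix → Row × Var × Bool → Set (r ⊔ a)
  Resolved X I M (j , v , b) =
    M j v ≢ nothing ⊎ ∃[ φ ] φ v ≡ b × (∀ {i} → i ∈ I → i ≢ j → Satisfies M X φ i)

  resolved-⊑ : ∀ {t} → M ⊑ M′ → Resolved X I M t → Resolved X I M′ t
  resolved-⊑ M⊑M′ (inj₁ ne)               = inj₁ (⊑-occurs M⊑M′ ne)
  resolved-⊑ M⊑M′ (inj₂ (φ , φv≡b , sat)) =
    inj₂ (φ , φv≡b , λ i∈I i≢j → ⊑-satisfies M⊑M′ (sat i∈I i≢j))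

  -- Critical assignments and occurrences survive the addition of literals; only unsatisfiability
  -- has to be checked anew.
  minUnsat-⊑ : M ⊑ M′ → ¬ Satisfiable M′ X I → MinUnsat M X I → MinUnsat M′ X I
  minUnsat-⊑ M⊑M′ ¬sat mu = record
    { unsat    = ¬sat
    ; critical = λ j∈I → ⊑-critical M⊑M′ (critical mu j∈I)
    ; occurs   = λ v∈X → Any.map (⊑-occurs M⊑M′) (occurs mu v∈X)
    }

  resolve : MinUnsat M X I → ∀ t → ∃[ M′ ] M ⊑ M′ × MinUnsat M′ X I × Resolved X I M′ t
  resolve {M} {X} {I} mu (j , v , b) with M j v ≟ₑ nothing
  ... | no ne  = M , (λ _ _ eq → eq) , mu , inj₁ ne
  ... | yes eq with satisfiable? (setEntry M j v b) X I
  ...   | no ¬sat = setEntry M j v b , setEntry-⊑ eq , minUnsat-⊑ (setEntry-⊑ eq) ¬sat mu ,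
                    inj₁ (λ eq′ → contradiction (trans (sym (setEntry-same M j v b)) eq′) λ ())
  ...   | yes (φ , sat) = M , (λ _ _ eq → eq) , mu , inj₂ (φ , φv≡b , others)
    where
    others : ∀ {i} → i ∈ I → i ≢ j → Satisfies M X φ i
    others i∈I i≢j = Any.map (trans (sym (setEntry-other M j v b (inj₁ i≢j)))) (All.lookup sat i∈I)
    φv≡b : φ v ≡ b
    φv≡b = decidable-stable (φ v Bool.≟ b) λ φv≢b → unsat mu (φ , All.tabulate λ {i} i∈I →
      Any.map (λ {w} eq′ → entry φv≢b eq′) (All.lookup sat i∈I))
      where
      entry : φ v ≢ b → ∀ {i w} → setEntry M j v b i w ≡ just (φ w) → M i w ≡ just (φ w)
      entry φv≢b {i} {w} eq′ with i ≟ᵣ j | w ≟ v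
      ... | yes _ | yes refl = contradiction (sym (Maybe.just-injective eq′)) φv≢b
      ... | yes _ | no _     = eq′
      ... | no _  | _        = eq′

  -- One pass suffices: by `resolved-⊑`, later additions do not undo what was achieved for an
  -- earlier entry.
  resolveAll : ∀ L → MinUnsat M X I →
    ∃[ M′ ] M ⊑ M′ × MinUnsat M′ X I × All (Resolved X I M′) L
  resolveAll {M} [] mu = M , (λ _ _ eq → eq) , mu , []
  resolveAll (t ∷ L) mu
    with M₁ , M⊑M₁ , mu₁ , res ← resolve mu t
    with M₂ , M₁⊑M₂ , mu₂ , ress ← resolveAll L mu₁ =
    M₂ , (λ _ _ eq → M₁⊑M₂ _ _ (M⊑M₁ _ _ eq)) , mu₂ , resolved-⊑ M₁⊑M₂ res ∷ ress

  Saturated : Matrix → List Var → List Row → Set (r ⊔ a)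
  Saturated M X I = ∀ {j v b} → j ∈ I → v ∈ X → Resolved X I M (j , v , b)

  saturate : MinUnsat M X I → ∃[ M′ ] M ⊑ M′ × MinUnsat M′ X I × Saturated M′ X I
  saturate {X = X} {I} mu
    with M′ , M⊑M′ , mu′ , res ←
      resolveAll (cartesianProduct I (cartesianProduct X (true ∷ false ∷ []))) mu =
    M′ , M⊑M′ , mu′ , λ {j} {v} {b} j∈I v∈X →
      All.lookup res (∈-cartesianProduct⁺ j∈I (∈-cartesianProduct⁺ v∈X (bool∈ b)))
    where
    bool∈ : ∀ b → b ∈ true ∷ false ∷ []
    bool∈ true  = here refl
    bool∈ false = there (here refl)

  -- Assigning a variable of minimum degree.

  both-signs : MinUnsat M X I → v ∈ X → ∀ b → Any (λ i → M i v ≡ just b) I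
  both-signs {M} {X} {I} {v} mu v∈X b with any? (λ i → M i v ≟ₑ just b) I
  ... | yes any = any
  -- Now every occurrence of `v` has sign `not b`. Resetting `v` to `not b` in a critical assignment
  -- for `j` satisfies row `j` and keeps the other rows satisfied.
  ... | no none with j , j∈I , ne ← find (occurs mu v∈X) with φ , sat ← critical mu j∈I =
    contradiction (φ [ v ≔ not b ] , All.tabulate row) (unsat mu)
    where
    occurring : ∀ {i} → i ∈ I → M i v ≢ nothing → M i v ≡ just (not b)
    occurring {i} i∈I ne with M i v in eq
    ... | nothing = contradiction refl ne
    ... | just c  = cong just (Bool.¬-not λ { refl → none (lose i∈I eq) })
    at-v : ∀ {i} → M i v ≡ just (not b) → Satisfies M X (φ [ v ≔ not b ]) i
    at-v eq = lose v∈X (trans eq (cong just (sym (update-same φ v (not b)))))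
    row : ∀ {i} → i ∈ I → Satisfies M X (φ [ v ≔ not b ]) i
    row {i} i∈I with i ≟ᵣ j
    ... | yes refl = at-v (occurring i∈I ne)
    ... | no i≢j with w , w∈X , eq ← find (sat i∈I i≢j) with w ≟ v
    ...   | yes refl = at-v (occurring i∈I λ eq′ → contradiction (trans (sym eq) eq′) λ ())
    ...   | no w≢v   = lose w∈X (trans eq (cong just (sym (update-other φ (not b) w≢v))))

  lacking : Matrix → Var → Bool → List Row → List Row
  lacking M v b = filter (λ i → ¬? (M i v ≟ₑ just b))

  -- Unsatisfiability passes down because a satisfying assignment could be extended by v = b.
  -- Saturation supplies critical assignments that already have v = b, and the minimum degree of `v`
  -- keeps every other variable present.
  assign-minUnsat : MinUnsat M X I → Saturated M X I → v ∈ X →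
    (∀ {w} → w ∈ X → vdeg M I v ≤ vdeg M I w) → ∀ b →
    MinUnsat M (without _≟_ v X) (lacking M v b I)
  assign-minUnsat {M} {X} {I} {v} mu saturated v∈X v-min b = record
    { unsat = unsat′ ; critical = critical′ ; occurs = occurs′ }
    where
    ∈X⁻ : ∀ {w} → w ∈ without _≟_ v X → w ∈ X × w ≢ v
    ∈X⁻ = ∈-filter⁻ (λ w → ¬? (w ≟ v))
    ∈I⁻ : ∀ {i} → i ∈ lacking M v b I → i ∈ I × M i v ≢ just b
    ∈I⁻ = ∈-filter⁻ (λ i → ¬? (M i v ≟ₑ just b))

    unsat′ : ¬ Satisfiable M (without _≟_ v X) (lacking M v b I)
    unsat′ (φ , sat) = unsat mu (φ [ v ≔ b ] , All.tabulate row)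
      where
      row : ∀ {i} → i ∈ I → Satisfies M X (φ [ v ≔ b ]) i
      row {i} i∈I with M i v ≟ₑ just b
      ... | yes eq = lose v∈X (trans eq (cong just (sym (update-same φ v b))))
      ... | no ne
        with w , w∈ , eq ← find (All.lookup sat (∈-filter⁺ (λ i → ¬? (M i v ≟ₑ just b)) i∈I ne))
        with w∈X , w≢v ← ∈X⁻ w∈ = lose w∈X (trans eq (cong just (sym (update-other φ b w≢v))))

    literal-true : ∀ {j} → j ∈ I → M j v ≢ just b →
      ∃[ φ ] φ v ≡ b × (∀ {i} → i ∈ I → i ≢ j → Satisfies M X φ i)
    literal-true {j} j∈I ne with saturated {b = b} j∈I v∈X
    ... | inj₂ res = res
    -- Row `j` contains the opposite literal of `v`. A critical assignment making that literal true
    -- would satisfy all rows, so it sets `v` to `b`.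
    ... | inj₁ occ with φ , sat ← critical mu j∈I =
      φ , decidable-stable (φ v Bool.≟ b) (λ φv≢b → unsat mu (φ , All.tabulate (row φv≢b))) , sat
      where
      entry : ∀ {c} → c ≢ b → M j v ≡ just c
      entry c≢b with M j v
      ... | nothing = contradiction refl occ
      ... | just d  = cong just (trans (Bool.¬-not (ne ∘ cong just)) (sym (Bool.¬-not c≢b)))
      row : φ v ≢ b → ∀ {i} → i ∈ I → Satisfies M X φ i
      row φv≢b {i} i∈I with i ≟ᵣ j
      ... | yes refl = lose v∈X (entry φv≢b)
      ... | no i≢j   = sat i∈I i≢j

    critical′ : ∀ {j} → j ∈ lacking M v b I → Critical M (without _≟_ v X) (lacking M v b I) j
    critical′ j∈ with j∈I , ne ← ∈I⁻ j∈ with φ , φv≡b , sat ← literal-true j∈I ne =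
      φ , row
      where
      row : ∀ {i} → i ∈ lacking M v b I → i ≢ _ → Satisfies M (without _≟_ v X) φ i
      -- Row `i` lacks the literal that φ makes true at `v`, so it is satisfied in another column.
      row i∈ i≢j with i∈I , ne′ ← ∈I⁻ i∈ with w , w∈X , eq ← find (sat i∈I i≢j) =
        lose (∈-filter⁺ (λ w → ¬? (w ≟ v)) w∈X λ { refl → ne′ (trans eq (cong just φv≡b)) }) eq

    -- Otherwise every row containing w contains the literal of v made true, so
    -- w has smaller degree than v, which also occurs with the other sign.
    occurs′ : ∀ {w} → w ∈ without _≟_ v X → Any (λ i → M i w ≢ nothing) (lacking M v b I)
    occurs′ {w} w∈ with any? (λ i → ¬? (M i w ≟ₑ nothing)) (lacking M v b I)
    ... | yes any = any
    ... | no none = contradiction (v-min (proj₁ (∈X⁻ w∈))) (<⇒≱ (begin-strict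
      vdeg M I w                        ≤⟨ count-mono {xs = I} (λ i → ¬? (M i w ≟ₑ nothing))
                                             (λ i → M i v ≟ₑ just b) covered ⟩
      ld M I v b                        <⟨ m<m+n _ (filter-some _ (both-signs mu v∈X (not b))) ⟩
      ld M I v b + ld M I v (not b)     ≡⟨ sym (vdeg≡ld+ld M I v b) ⟩
      vdeg M I v                        ∎))
      where
      open ≤-Reasoning
      covered : ∀ {i} → i ∈ I → M i w ≢ nothing → M i v ≡ just b
      covered {i} i∈I occ = decidable-stable (M i v ≟ₑ just b) λ ne →
        none (lose (∈-filter⁺ (λ i → ¬? (M i v ≟ₑ just b)) i∈I ne) occ)

  -- The degree bounds for minimally unsatisfiable matrices.

  LowVariable : Matrix → List Var → List Row → ℕ → Set a
  LowVariable M X I k = ∃[ v ] v ∈ X × vdeg M I v ≤ N k × (∀ b → ld M I v b ≤ k)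

  lowVariable-⊑ : ∀ {k} → M ⊑ M′ → LowVariable M′ X I k → LowVariable M X I k
  lowVariable-⊑ {M} {M′} {I = I} M⊑M′ (v , v∈X , deg≤ , ld≤) =
    v , v∈X ,
    ≤-trans (count-mono {xs = I} (λ i → ¬? (M i v ≟ₑ nothing)) (λ i → ¬? (M′ i v ≟ₑ nothing))
                        (λ _ → ⊑-occurs M⊑M′)) deg≤ ,
    λ b → ≤-trans (count-mono {xs = I} (λ i → M i v ≟ₑ just b) (λ i → M′ i v ≟ₑ just b)
                              (λ _ → M⊑M′ _ v)) (ld≤ b)

  minimum-vdeg : ∀ M I x xs → ∃[ v ] v ∈ x ∷ xs × (∀ {w} → w ∈ x ∷ xs → vdeg M I v ≤ vdeg M I w)
  minimum-vdeg M I x xs = argmin deg x xs , member , λ where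
      (here refl) → f[argmin]≤f[⊤] {f = deg} x xs
      (there w∈)  → All.lookup (f[argmin]≤f[xs] {f = deg} x xs) w∈
    where
    deg = vdeg M I
    member : argmin deg x xs ∈ x ∷ xs
    member = [ here , there ]′ (argmin-sel deg x xs)

  -- A low variable `w` left after the assignment loses at most one occurrence for each of the
  -- `ld M I v b` deleted rows, and the degree of `v` is no larger than that of `w`.
  vdeg≤N+ld : (∀ {w} → w ∈ X → vdeg M I v ≤ vdeg M I w) → ∀ {k} b →
    length (lacking M v b I) ≡ suc k + length (without _≟_ v X) →
    (0 < length (without _≟_ v X) → LowVariable M (without _≟_ v X) (lacking M v b I) (suc k)) →
    vdeg M I v ≤ N (suc k) + ld M I v b
  vdeg≤N+ld {X} {M} {I} {v} v-min {k} b |J|≡ low =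
    [ from-low ∘ low , no-variables ∘ sym ]′ (m≤n⇒m<n∨m≡n z≤n)
    where
    open ≤-Reasoning
    J = lacking M v b I
    ℓ = ld M I v b
    -- Without a remaining variable, the rows are counted instead: those containing the opposite
    -- literal of `v` lie in `J`, which has only `suc k` rows.
    no-variables : length (without _≟_ v X) ≡ 0 → vdeg M I v ≤ N (suc k) + ℓ
    no-variables |Y|≡0 = begin
      vdeg M I v              ≡⟨ vdeg≡ld+ld M I v b ⟩
      ℓ + ld M I v (not b)    ≤⟨ +-monoʳ-≤ ℓ (count-mono {xs = I} (λ i → M i v ≟ₑ just (not b))
                                   (λ i → ¬? (M i v ≟ₑ just b))
                                   λ _ eq eq′ → Bool.not-¬ refl (Maybe.just-injective (trans (sym eq′) eq))) ⟩
      ℓ + length J            ≡⟨ cong (ℓ +_) (trans |J|≡ (trans (cong (suc k +_) |Y|≡0) (+-identityʳ (suc k)))) ⟩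
      ℓ + suc k               ≤⟨ +-monoʳ-≤ ℓ (≤-trans (n≤1+n _) (2+k≤N k)) ⟩
      ℓ + N (suc k)           ≡⟨ +-comm ℓ _ ⟩
      N (suc k) + ℓ           ∎
    from-low : LowVariable M (without _≟_ v X) J (suc k) → vdeg M I v ≤ N (suc k) + ℓ
    from-low (w , w∈Y , deg-w , _) = +-cancelʳ-≤ (length J) _ _ (begin
      vdeg M I v + length J   ≤⟨ +-monoˡ-≤ (length J) (v-min (proj₁ (∈-filter⁻ (λ w → ¬? (w ≟ v)) {xs = X} w∈Y))) ⟩
      vdeg M I w + length J   ≤⟨ count-⊆ (λ i → ¬? (M i w ≟ₑ nothing)) (filter-⊆ (λ i → ¬? (M i v ≟ₑ just b)) I) ⟩
      vdeg M J w + length I   ≤⟨ +-monoˡ-≤ (length I) deg-w ⟩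
      N (suc k) + length I    ≡⟨ cong (N (suc k) +_) (sym (count-∁ (λ i → M i v ≟ₑ just b) I)) ⟩
      N (suc k) + (ℓ + length J) ≡⟨ sym (+-assoc (N (suc k)) ℓ _) ⟩
      N (suc k) + ℓ + length J ∎)

  -- Induction on the number of variables. Positive deficiency is proved together with the degree
  -- bounds, since its positivity after an assignment bounds the literal degrees before it.
  minUnsat-low : ∀ n → length X ≡ n → Unique X → MinUnsat M X I →
    ∃[ k ] length I ≡ suc k + length X × (0 < length X → LowVariable M X I (suc k))
  -- An empty list of rows is satisfiable, so without variables there is at least one row and the
  -- deficiency is positive.
  minUnsat-low {[]} {I = []} zero _ _ mu = contradiction (const false , []) (unsat mu)
  minUnsat-low {[]} {I = _ ∷ I} zero _ _ mu = length I , sym (+-identityʳ _) , λ ()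
  minUnsat-low {x ∷ xs} {M} {I} (suc n) |X|≡ uniq mu
    with M′ , M⊑M′ , mu′ , saturated ← saturate mu
    with v , v∈X , v-min ← minimum-vdeg M′ I x xs =
    conclude k (≤-trans (1≤ℓ true) (m≤n+m _ _)) (|I|≡ true)
      (λ _ → lowVariable-⊑ {I = I} M⊑M′ (v , v∈X , deg≤ , ld≤))
    where
    open ≤-Reasoning
    conclude : ∀ k → 1 ≤ k → length I ≡ k + length (x ∷ xs) →
      (0 < length (x ∷ xs) → LowVariable M (x ∷ xs) I k) →
      ∃[ k ] length I ≡ suc k + length (x ∷ xs) × (0 < length (x ∷ xs) → LowVariable M (x ∷ xs) I (suc k))
    conclude (suc k) _ eq low = k , eq , low
    Y = without _≟_ v (x ∷ xs)
    I∖ : Bool → List Row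
    I∖ b = lacking M′ v b I
    ℓ : Bool → ℕ
    ℓ b = ld M′ I v b
    |X|≡1+|Y| : length (x ∷ xs) ≡ suc (length Y)
    |X|≡1+|Y| = length-without _≟_ uniq v∈X
    ih : ∀ b → ∃[ k ] length (I∖ b) ≡ suc k + length Y × (0 < length Y → LowVariable M′ Y (I∖ b) (suc k))
    ih b = minUnsat-low n (suc-injective (trans (sym |X|≡1+|Y|) |X|≡))
      (Unique.filter⁺ (λ w → ¬? (w ≟ v)) uniq)
      (assign-minUnsat mu′ saturated v∈X v-min b)
    -- One less than the deficiency after v = b. With deficiency k before and i = `ℓ b`, it is k -
    -- i, so `N (suc (κ b))` is N (k - i + 1).
    κ : Bool → ℕ
    κ b = proj₁ (ih b)
    ℓ+|I∖| : ∀ b → ℓ b + length (I∖ b) ≡ length I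
    ℓ+|I∖| b = count-∁ (λ i → M′ i v ≟ₑ just b) I
    |I|≡ : ∀ b → length I ≡ κ b + ℓ b + length (x ∷ xs)
    |I|≡ b = begin-equality
      length I                         ≡⟨ sym (ℓ+|I∖| b) ⟩
      ℓ b + length (I∖ b)              ≡⟨ cong (ℓ b +_) (proj₁ (proj₂ (ih b))) ⟩
      ℓ b + (suc (κ b) + length Y)     ≡⟨ cong (ℓ b +_) (sym (+-suc (κ b) (length Y))) ⟩
      ℓ b + (κ b + suc (length Y))     ≡⟨ sym (+-assoc (ℓ b) (κ b) _) ⟩
      ℓ b + κ b + suc (length Y)       ≡⟨ cong₂ _+_ (+-comm (ℓ b) (κ b)) (sym |X|≡1+|Y|) ⟩
      κ b + ℓ b + length (x ∷ xs)      ∎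
    k = κ true + ℓ true
    -- Both signs give the same sum, because either one added to the number of variables yields
    -- `length I`.
    k≡ : ∀ b → κ b + ℓ b ≡ k
    k≡ b = +-cancelʳ-≡ (length (x ∷ xs)) _ _ (trans (sym (|I|≡ b)) (|I|≡ true))
    1≤ℓ : ∀ b → 1 ≤ ℓ b
    1≤ℓ b = filter-some _ (both-signs mu′ v∈X b)
    ld≤ : ∀ b → ℓ b ≤ k
    ld≤ b = subst (ℓ b ≤_) (k≡ b) (m≤n+m _ _)
    deg≤N+ℓ : ∀ b → vdeg M′ I v ≤ N (suc (κ b)) + ℓ b
    deg≤N+ℓ b = vdeg≤N+ld {M = M′} {I = I} v-min b (proj₁ (proj₂ (ih b))) (proj₂ (proj₂ (ih b)))
    deg≤-via : ∀ b → ℓ (not b) ≤ ℓ b → vdeg M′ I v ≤ N k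
    deg≤-via b ℓ≤ with ≤-<-connex 2 (ℓ b)
    ... | inj₁ 2≤ℓ = begin
      vdeg M′ I v                          ≤⟨ ⊓-glb deg≤2ℓ (deg≤N+ℓ b) ⟩
      (2 * ℓ b) ⊓ (N (suc (κ b)) + ℓ b)    ≤⟨ N-lower (κ b) 2≤ℓ ⟩
      N (κ b + ℓ b)                        ≡⟨ cong N (k≡ b) ⟩
      N k                                  ∎
      where
      deg≤2ℓ : vdeg M′ I v ≤ 2 * ℓ b
      deg≤2ℓ = begin
        vdeg M′ I v        ≡⟨ vdeg≡ld+ld M′ I v b ⟩
        ℓ b + ℓ (not b)    ≤⟨ +-monoʳ-≤ (ℓ b) ℓ≤ ⟩
        ℓ b + ℓ b          ≡⟨ cong (ℓ b +_) (sym (+-identityʳ (ℓ b))) ⟩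
        2 * ℓ b            ∎
    -- The index 1 is outside the range of the maximum, but then `v` has degree at most 2 = `N 1`.
    ... | inj₂ (s≤s ℓ≤1) = begin
      vdeg M′ I v          ≡⟨ vdeg≡ld+ld M′ I v b ⟩
      ℓ b + ℓ (not b)      ≤⟨ +-mono-≤ ℓ≤1 (≤-trans ℓ≤ ℓ≤1) ⟩
      2                    ≤⟨ 2≤N k (≤-trans (1≤ℓ true) (m≤n+m _ _)) ⟩
      N k                  ∎
      where
      2≤N : ∀ k → 1 ≤ k → 2 ≤ N k
      2≤N (suc k) _ = ≤-trans (m≤m+n 2 k) (2+k≤N k)
    deg≤ : vdeg M′ I v ≤ N k
    deg≤ = [ deg≤-via false , deg≤-via true ]′ (≤-total (ℓ true) (ℓ false))

-- From lean multi-clause-sets to sign matrices.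

module LeanClauses {a} {Var : Set a} (_≟_ : DecidableEquality Var) where

  open Clauses _≟_
  open DecMembership _≟_ using (_∈?_)
  open DecMembership _≟ˡ_ using () renaming (_∈_ to _∈ˡ_; _∈?_ to _∈ˡ?_)

  literal : Bool → Var → Literal
  literal true  = pos
  literal false = neg

  -- Testing `pos` first loses nothing: by `clashFree` no clause contains both literals of a
  -- variable.
  sign : Clause → Var → Maybe Bool
  sign C v with pos v ∈ˡ? literals C | neg v ∈ˡ? literals C
  ... | yes _ | _     = just true
  ... | no _  | yes _ = just false
  ... | no _  | no _  = nothing

  sign⁻ : ∀ C {v b} → sign C v ≡ just b → literal b v ∈ˡ literals C
  sign⁻ C {v} eq with pos v ∈ˡ? literals C | neg v ∈ˡ? literals C | eq
  ... | yes x∈ | _      | refl = x∈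
  ... | no _   | yes x∈ | refl = x∈

  sign⁺ : ∀ C {v} b → literal b v ∈ˡ literals C → sign C v ≡ just b
  sign⁺ C {v} b x∈ with pos v ∈ˡ? literals C | neg v ∈ˡ? literals C | b
  ... | yes _   | _       | true  = refl
  ... | yes pos∈ | _      | false = contradiction x∈ (clashFree C (pos v) pos∈)
  ... | no pos∉ | _       | true  = contradiction x∈ pos∉
  ... | no _    | yes _   | false = refl
  ... | no _    | no neg∉ | false = contradiction x∈ neg∉

  Touches : List Var → Clause → Set a
  Touches V C = Any (λ x → var x ∈ V) (literals C)

  touches? : ∀ V → Decidable (Touches V)
  touches? V C = any? (λ x → var x ∈? V) (literals C)

  literal∈⇒touches : ∀ C {V v} b → literal b v ∈ˡ literals C → v ∈ V → Touches V C
  literal∈⇒touches C true  x∈ v∈V = lose x∈ v∈V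
  literal∈⇒touches C false x∈ v∈V = lose x∈ v∈V

  sign-var : ∀ C {x} → x ∈ˡ literals C → sign C (var x) ≢ nothing
  sign-var C {pos v} x∈ eq with () ← trans (sym (sign⁺ C true x∈)) eq
  sign-var C {neg v} x∈ eq with () ← trans (sym (sign⁺ C false x∈)) eq

  surplus-attained : ∀ F → 0 < n F → ∃[ V ] V ⊆ vars F × 0 < length V × σ F ≡ excess F V
  surplus-attained F 0<n with ℤ-argmin-sel (excess F (vars F)) (map (excess F) (nonemptySublists (vars F)))
    where ℤ-argmin-sel = Extrema.argmin-sel ℤ.≤-totalOrder id
  -- The default candidate of `minℤ` belongs to V = var(F), which is admissible because it is
  -- nonempty.
  ... | inj₁ σ≡ = vars F , ⊆-refl , 0<n , σ≡
  ... | inj₂ σ∈ with V , V∈ , σ≡ ← ∈-map⁻ (excess F) σ∈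
                with V⊆ , 0<V ← ∈-nonemptySublists⁻ (vars F) V∈ = V , V⊆ , 0<V , σ≡

  surplus-≤ : ∀ F {V} → V ⊆ vars F → 0 < length V → σ F ℤ.≤ excess F V
  surplus-≤ F V⊆ 0<V = All.lookup
    (Extrema.min≤xs ℤ.≤-totalOrder (excess F (vars F)) (map (excess F) (nonemptySublists (vars F))))
    (∈-map⁺ (excess F) (∈-nonemptySublists⁺ V⊆ 0<V))

  minvdeg-≤ : ∀ F {v m} → v ∈ vars F → vdeg F v ≤ m → minvdeg F ≤⁺ [ m ]
  minvdeg-≤ F v∈ deg≤ = Extrema.min≤v⁺ ≤⁺-totalOrder ⊤⁺ _
    (inj₂ (Any.map⁺ (lose v∈ Supremum.[ deg≤ ])))

  module _ (F : MultiClauseSet) where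

    -- Rows are positions in `F`, so repeated clauses stay distinct and multiplicities are counted.
    open SignMatrix (Fin._≟_ {length F}) _≟_ renaming (ld to ldᴹ; vdeg to vdegᴹ) hiding (Satisfies)

    matrix : Matrix
    matrix i = sign (lookup F i)

    touchingRows : List Var → List (Fin (length F))
    touchingRows V = filter (λ i → touches? V (lookup F i)) (allFin (length F))

    length-touchingRows : ∀ V → length (touching V F) ≡ length (touchingRows V)
    length-touchingRows V = count-lookup (touches? V) F

    -- A clause containing a literal of `v` touches `V`, so restricting to touching rows loses none
    -- of the degree.
    ld≤ldᴹ : ∀ {v V} b → v ∈ V → ld F (literal b v) ≤ ldᴹ matrix (touchingRows V) v b
    ld≤ldᴹ {v} {V} b v∈V = ≤-trans
      (≤-reflexive (count-lookup (λ C → literal b v ∈ˡ? literals C) F))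
      (count-filter {xs = allFin (length F)}
        (λ i → literal b v ∈ˡ? literals (lookup F i)) (λ i → touches? V (lookup F i))
        (λ i → matrix i v ≟ₑ just b)
        (λ {i} _ x∈ → literal∈⇒touches (lookup F i) b x∈ v∈V , sign⁺ (lookup F i) b x∈))

    -- Restrict a satisfying assignment to `V`. A clause with a falsified literal touches `V`, hence
    -- is one of the satisfied rows; so this is an autarky, and its domain `V` is nonempty.
    lean⇒unsat : Lean F → ∀ {V} → V ⊆ vars F → 0 < length V →
                 ¬ Satisfiable matrix V (touchingRows V)
    lean⇒unsat lean {V@(v ∷ _)} V⊆ _ (φ , sat) =
      lean (ψ , All.tabulate autark , v , ⊆-lookup V⊆ (here refl) , v∈dom (here refl))
      where
      val : Var → Maybe Bool
      val w with w ∈? V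
      ... | yes _ = just (φ w)
      ... | no _  = nothing
      val-∈ : ∀ {w} → w ∈ V → val w ≡ just (φ w)
      val-∈ {w} w∈ with w ∈? V
      ... | yes _ = refl
      ... | no w∉ = contradiction w∈ w∉
      val-just : ∀ w → Is-just (val w) → w ∈ V
      val-just w just? with w ∈? V | just?
      ... | yes w∈ | _ = w∈
      ... | no _   | ()
      ψ : PartialAssignment
      ψ = record { value = val ; finiteDomain = V , val-just }
      v∈dom : ∀ {w} → w ∈ V → w ∈dom ψ
      v∈dom w∈ rewrite val-∈ w∈ = MaybeAny.just _
      falsified∈ : ∀ x → Falsifies ψ x → var x ∈ V
      falsified∈ (pos w) eq with w ∈? V | eq
      ... | yes w∈ | _ = w∈
      ... | no _   | ()
      falsified∈ (neg w) eq with w ∈? V | eq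
      ... | yes w∈ | _ = w∈
      ... | no _   | ()
      satisfied : ∀ {w} → w ∈ V → Satisfies ψ (literal (φ w) w)
      satisfied {w} w∈ with φ w in eq
      ... | true  = trans (val-∈ w∈) (cong just eq)
      ... | false = cong (Data.Maybe.map not) (trans (val-∈ w∈) (cong just eq))
      row : ∀ i → Touches V (lookup F i) → Any (Satisfies ψ) (literals (lookup F i))
      row i touches
        with w , w∈V , eq ← find (All.lookup sat (∈-filter⁺ (λ i → touches? V (lookup F i)) (∈-allFin i) touches)) =
        lose (sign⁻ (lookup F i) eq) (satisfied w∈V)
      autark : ∀ {C} → C ∈ F → Any (Falsifies ψ) (literals C) → Any (Satisfies ψ) (literals C)
      autark C∈F rewrite Any.lookup-index C∈F =
        row (Any.index C∈F) ∘ Any.map (λ {x} → falsified∈ x)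

    -- The variables attaining the surplus and their minimal rows.

    module MinimalRows {V J} (V⊆ : V ⊆ vars F) (0<V : 0 < length V) (σ≡ : σ F ≡ excess F V)
      (J⊆ : J ⊆ touchingRows V) (¬sat : ¬ Satisfiable matrix V J)
      (crit : ∀ {j} → j ∈ touchingRows V → j ∈ J → Critical matrix V J j) where

      I : List (Fin (length F))
      I = touchingRows V

      occurs? : Decidable (λ v → Any (λ i → matrix i v ≢ nothing) J)
      occurs? v = any? (λ i → ¬? (matrix i v ≟ₑ nothing)) J

      -- Deleting rows might remove variables: `V₁` has those still occurring in `J`, and `V₂`, the
      -- lost ones, turns out empty.
      V₁ V₂ : List Var
      V₁ = filter occurs? V
      V₂ = filter (¬? ∘ occurs?) V

      mu : MinUnsat matrix V₁ J
      mu = record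
        { unsat    = λ (φ , sat) → ¬sat (φ , All.map (λ s → ⊆-any s) sat)
        ; critical = λ {j} j∈J → let φ , sat = crit (⊆-lookup J⊆ j∈J) j∈J in
            φ , λ i∈J i≢j → let w , w∈V , eq = find (sat i∈J i≢j) in
              lose (∈-filter⁺ occurs? w∈V (lose i∈J λ eq′ → contradiction (trans (sym eq) eq′) λ ())) eq
        ; occurs   = λ v∈ → proj₂ (∈-filter⁻ occurs? {xs = V} v∈)
        }
        where
        ⊆-any : ∀ {p} {P : Pred Var p} → Any P V₁ → Any P V
        ⊆-any any with w , w∈ , pw ← find any = lose (proj₁ (∈-filter⁻ occurs? w∈)) pw

      module Deficiency {k} (|J|≡ : length J ≡ suc k + length V₁)
        (low : 0 < length V₁ → LowVariable matrix V₁ J (suc k)) where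

        -- The deficiency of the minimal rows and the number of deleted rows; their sum will be the
        -- surplus.
        κ r : ℕ
        κ = suc k
        r = length I ∸ length J

        |V|≡ : length V ≡ length V₁ + length V₂
        |V|≡ = sym (count-∁ occurs? V)

        |I|≡ : length I ≡ r + length J
        |I|≡ = sym (m∸n+n≡m (length-mono-≤ J⊆))

        -- Rows of J have no entries in V₂, so a nonempty V₂ would have excess below σ F.
        ¬0<V₂ : ¬ 0 < length V₂
        ¬0<V₂ 0<V₂ = ℤ.<⇒≱ (minus-< _ (length V₂) _ (length V) crossed)
          (subst (ℤ._≤ excess F V₂) σ≡ (surplus-≤ F (⊆-trans (filter-⊆ (¬? ∘ occurs?) V) V⊆) 0<V₂))
          where
          untouched : ∀ {i} → i ∈ J → ¬ Touches V₂ (lookup F i)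
          untouched {i} i∈J touches with x , x∈ , x∈V₂ ← find touches =
            proj₂ (∈-filter⁻ (¬? ∘ occurs?) {xs = V} x∈V₂) (lose i∈J (sign-var (lookup F i) x∈))
          open ≤-Reasoning
          touching-I : length (touching V₂ F) ≤ count (λ i → touches? V₂ (lookup F i)) I
          touching-I = ≤-trans (≤-reflexive (length-touchingRows V₂))
            (count-filter {xs = allFin (length F)}
              (λ i → touches? V₂ (lookup F i)) (λ i → touches? V (lookup F i)) (λ i → touches? V₂ (lookup F i))
              (λ _ t → Any.map (λ x∈ → proj₁ (∈-filter⁻ (¬? ∘ occurs?) x∈)) t , t))
          -- Rows touching `V₂` also touch `V` but are not in `J`, so they are among the deleted
          -- rows.
          touching-bound : length (touching V₂ F) + length J ≤ length I
          touching-bound = begin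
            length (touching V₂ F) + length J
              ≤⟨ +-monoˡ-≤ (length J) touching-I ⟩
            count (λ i → touches? V₂ (lookup F i)) I + length J
              ≤⟨ count-⊆ (λ i → touches? V₂ (lookup F i)) J⊆ ⟩
            count (λ i → touches? V₂ (lookup F i)) J + length I
              ≡⟨ cong (λ is → length is + length I)
                   (filter-none (λ i → touches? V₂ (lookup F i)) {xs = J} (All.tabulate untouched)) ⟩
            length I ∎
          -- Strictness comes from the positive deficiency of `J`, that is, from `length V₁` <
          -- `length J`.
          crossed : length (touching V₂ F) + length V < length (touching V F) + length V₂
          crossed = begin-strict
            length (touching V₂ F) + length V
              ≡⟨ cong (length (touching V₂ F) +_) |V|≡ ⟩
            length (touching V₂ F) + (length V₁ + length V₂)
              ≡⟨ sym (+-assoc (length (touching V₂ F)) _ _) ⟩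
            length (touching V₂ F) + length V₁ + length V₂
              <⟨ +-monoˡ-< (length V₂) (+-monoʳ-< (length (touching V₂ F))
                   (subst (length V₁ <_) (sym |J|≡) (m<n+m (length V₁) (s≤s z≤n)))) ⟩
            length (touching V₂ F) + length J + length V₂
              ≤⟨ +-monoˡ-≤ (length V₂) touching-bound ⟩
            length I + length V₂
              ≡⟨ cong (_+ length V₂) (sym (length-touchingRows V)) ⟩
            length (touching V F) + length V₂ ∎

        |V|≡|V₁| : length V ≡ length V₁
        |V|≡|V₁| = trans |V|≡ (trans (cong (length V₁ +_) (n≤0⇒n≡0 (≮⇒≥ ¬0<V₂))) (+-identityʳ _))

        excess≡ : excess F V ≡ ℤ.+ (κ + r)
        excess≡ = begin
          ℤ.+ length (touching V F) ℤ.- ℤ.+ length V ≡⟨ cong (λ m → ℤ.+ m ℤ.- ℤ.+ length V) touching≡ ⟩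
          ℤ.+ (κ + r + length V) ℤ.- ℤ.+ length V    ≡⟨ ℤ.m-n≡m⊖n (κ + r + length V) (length V) ⟩
          (κ + r + length V) ℤ.⊖ length V            ≡⟨ ℤ.⊖-≥ (m≤n+m (length V) (κ + r)) ⟩
          ℤ.+ (κ + r + length V ∸ length V)          ≡⟨ cong ℤ.+_ (m+n∸n≡m (κ + r) (length V)) ⟩
          ℤ.+ (κ + r)                                ∎
          where
          open ≡-Reasoning
          touching≡ : length (touching V F) ≡ κ + r + length V
          touching≡ = begin
            length (touching V F)      ≡⟨ length-touchingRows V ⟩
            length I                   ≡⟨ |I|≡ ⟩
            r + length J               ≡⟨ cong (r +_) |J|≡ ⟩
            r + (κ + length V₁)        ≡⟨ sym (+-assoc r κ _) ⟩
            r + κ + length V₁          ≡⟨ cong₂ _+_ (+-comm r κ) (sym |V|≡|V₁|) ⟩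
            κ + r + length V           ∎

        -- Putting the `r` deleted rows back raises each degree by at most `r`, which `N-+` absorbs
        -- in the bound on the variable degree.
        low-variable : ∃[ k ] 1 ≤ k × σ F ≡ ℤ.+ k ×
          ∃[ v ] v ∈ vars F × vdeg F v ≤ N k × (∀ b → ld F (literal b v) ≤ k)
        low-variable with v , v∈V₁ , deg≤ , ld≤ ← low (subst (0 <_) |V|≡|V₁| 0<V) =
          κ + r , s≤s z≤n , trans σ≡ excess≡ , v , ⊆-lookup V⊆ v∈V , deg , lds
          where
          v∈V : v ∈ V
          v∈V = proj₁ (∈-filter⁻ occurs? v∈V₁)
          open ≤-Reasoning
          I-bound : ∀ {p} {P : Pred _ p} (P? : Decidable P) → count P? I ≤ count P? J + r
          I-bound P? = +-cancelʳ-≤ (length J) _ _ (begin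
            count P? I + length J         ≤⟨ count-⊆ P? J⊆ ⟩
            count P? J + length I         ≡⟨ cong (count P? J +_) |I|≡ ⟩
            count P? J + (r + length J)   ≡⟨ sym (+-assoc (count P? J) r _) ⟩
            count P? J + r + length J     ∎)
          deg : vdeg F v ≤ N (κ + r)
          deg = begin
            ld F (pos v) + ld F (neg v)   ≤⟨ +-mono-≤ (ld≤ldᴹ true v∈V) (ld≤ldᴹ false v∈V) ⟩
            ldᴹ matrix I v true + ldᴹ matrix I v false ≡⟨ sym (vdeg≡ld+ld matrix I v true) ⟩
            vdegᴹ matrix I v              ≤⟨ I-bound (λ i → ¬? (matrix i v ≟ₑ nothing)) ⟩
            vdegᴹ matrix J v + r          ≤⟨ +-monoˡ-≤ r deg≤ ⟩
            N κ + r                       ≤⟨ N-+ k r   ⟩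
            N (κ + r)                     ∎
          lds : ∀ b → ld F (literal b v) ≤ κ + r
          lds b = begin
            ld F (literal b v)            ≤⟨ ld≤ldᴹ b v∈V ⟩
            ldᴹ matrix I v b              ≤⟨ I-bound (λ i → matrix i v ≟ₑ just b) ⟩
            ldᴹ matrix J v b + r          ≤⟨ +-monoˡ-≤ r (ld≤ b) ⟩
            κ + r                         ∎

      low-variable : ∃[ k ] 1 ≤ k × σ F ≡ ℤ.+ k ×
        ∃[ v ] v ∈ vars F × vdeg F v ≤ N k × (∀ b → ld F (literal b v) ≤ k)
      low-variable =
        let k , |J|≡ , low = minUnsat-low (length V₁) refl (Unique.filter⁺ occurs? V-unique) mu
        in Deficiency.low-variable |J|≡ low
        where
        V-unique : Unique V
        V-unique = Unique-⊆ V⊆ (UniqueDec.deduplicate-! _≟_ (concatMap (map var ∘ literals) F))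

    lean-low : Lean F → 0 < n F → ∃[ k ] 1 ≤ k × σ F ≡ ℤ.+ k ×
      ∃[ v ] v ∈ vars F × vdeg F v ≤ N k × (∀ b → ld F (literal b v) ≤ k)
    lean-low lean 0<n =
      let V , V⊆ , 0<V , σ≡ = surplus-attained F 0<n
          J , J⊆ , ¬sat , crit = minimise (touchingRows V) (lean⇒unsat lean V⊆ 0<V)
      in MinimalRows.low-variable V⊆ 0<V σ≡ J⊆ ¬sat crit

open import Data.Integer using (+_)

theorem9p10 : ∀ {a : Level} {Var : Set a} (_≟_ : DecidableEquality Var) →
    let open Clauses _≟_ in
    (F : MultiClauseSet) → Lean F → 0 < n F →
    ∃[ k ] 1 ≤ k × σ F ≡ + k × minvdeg F ≤⁺ [ N k ] ×
    (∃[ v ] v ∈ vars F × vdeg F v ≤ N k × ld F (pos v) ≤ k × ld F (neg v) ≤ k)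
theorem9p10 _≟_ F lean 0<n =
  let k , 1≤k , σ≡ , v , v∈ , deg≤ , ld≤ = LeanClauses.lean-low _≟_ F lean 0<n
  in k , 1≤k , σ≡ , LeanClauses.minvdeg-≤ _≟_ F v∈ deg≤ , v , v∈ , deg≤ , ld≤ true , ld≤ false
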